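{- For every non-empty closed convex set $K\subseteq\mathbb{R}^d$, the affine flat $M(K)$ exists and is unique; that is, among all affine flats $L\subseteq K$ there is exactly one for which $r(L)$ is minimal in the lexicographic order.
   Context: An affine flat in $\mathbb{R}^d$ is a non-empty affine subspace (of any dimension from $0$ to $d$). For an affine flat $L$ in $\mathbb{R}^d$, let $r(L)=(d-\dim L,\ \operatorname{dist}(\bar 0,L))$, where $\operatorname{dist}(\bar 0,L)$ is the Euclidean distance from the origin to $L$. Pairs are compared lexicographically: $(x,y)\le(x',y')$ if and only if $x<x'$, or $x=x'$ and $y\le y'$. For a closed convex set $K\subseteq\mathbb{R}^d$, $M(K)$ denotes the affine flat $L\subseteq K$ for which $r(L)$ is minimal (so it has the highest possible dimension among flats contained in $K$ and, among those, is closest to the origin). -}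

module Defs where

open import Algebra.Bundles using (CommutativeRing)
import Algebra.Properties.Semiring.Sum as Sum
open import Data.Nat.Base as ℕ using (ℕ; _∸_)
open import Data.Product using (_×_; _,_; ∃; ∃₂)
open import Data.Product.Relation.Binary.Lex.Strict using (×-Lex)
open import Data.Vec.Functional using (Vector)
open import Level using (0ℓ)
open import Relation.Binary.Core using (Rel)
open import Relation.Binary.Definitions using (_Respects_)
import Relation.Binary.Construct.NonStrictToStrict as ToStrict
open import Relation.Binary.PropositionalEquality using (_≡_)
open import Relation.Binary.Structures using (IsTotalOrder)
open import Relation.Nullary using (¬_)
open import Relation.Unary using (Pred; _∈_; _⊆_; _≐_; Satisfiable)

-- ℝ is axiomatised as a Dedekind-complete ordered field, which determines it
-- up to isomorphism in classical logic.
record RealField : Set₁ where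
  field
    commutativeRing : CommutativeRing 0ℓ 0ℓ

  open CommutativeRing commutativeRing public

  infix 4 _≤_
  field
    _≤_          : Rel Carrier 0ℓ
    isTotalOrder : IsTotalOrder _≈_ _≤_
    1≉0          : ¬ (1# ≈ 0#)
    inverse      : ∀ x → ¬ (x ≈ 0#) → ∃ λ y → x * y ≈ 1#
    +-monoˡ-≤    : ∀ z {x y} → x ≤ y → x + z ≤ y + z
    *-nonNeg     : ∀ {x y} → 0# ≤ x → 0# ≤ y → 0# ≤ x * y

  UpperBound : Pred Carrier 0ℓ → Pred Carrier 0ℓ
  UpperBound S b = ∀ {x} → x ∈ S → x ≤ b

  LowerBound : Pred Carrier 0ℓ → Pred Carrier 0ℓ
  LowerBound S b = ∀ {x} → x ∈ S → b ≤ x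

  IsSupremum : Pred Carrier 0ℓ → Pred Carrier 0ℓ
  IsSupremum S s = UpperBound S s × (∀ {b} → UpperBound S b → s ≤ b)

  IsInfimum : Pred Carrier 0ℓ → Pred Carrier 0ℓ
  IsInfimum S s = LowerBound S s × (∀ {b} → LowerBound S b → b ≤ s)

  field
    complete : ∀ (S : Pred Carrier 0ℓ) → Satisfiable S →
               Satisfiable (UpperBound S) → Satisfiable (IsSupremum S)

  open ToStrict _≈_ _≤_ public using (_<_)
  open Sum semiring public using (sum)

module Euclidean (ℝ : RealField) (d : ℕ) where

  open RealField ℝ

  Point : Set
  Point = Vector Carrier d

  infix  4 _≈ᵥ_ _≋_ _≤ₗₑₓ_ _≤ᵣ_
  infixl 6 _+ᵥ_ _-ᵥ_
  infixl 7 _·_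

  _≈ᵥ_ : Rel Point 0ℓ
  x ≈ᵥ y = ∀ i → x i ≈ y i

  0ᵥ : Point
  0ᵥ i = 0#

  _+ᵥ_ _-ᵥ_ : Point → Point → Point
  (x +ᵥ y) i = x i + y i
  (x -ᵥ y) i = x i - y i

  _·_ : Carrier → Point → Point
  (t · x) i = t * x i

  IsNorm : Point → Pred Carrier 0ℓ
  IsNorm x n = 0# ≤ n × n * n ≈ sum (λ i → x i * x i)

  Convex : Pred Point 0ℓ → Set
  Convex K = ∀ {x y} → x ∈ K → y ∈ K → ∀ {t} → 0# ≤ t → t ≤ 1# →
             ((1# - t) · x +ᵥ t · y) ∈ K

  InClosure : Pred Point 0ℓ → Pred Point 0ℓ
  InClosure K x = ∀ {ε} → 0# < ε →
                  ∃ λ y → y ∈ K × ∃ λ n → IsNorm (x -ᵥ y) n × n < ε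

  -- A closed set automatically respects _≈ᵥ_.
  Closed : Pred Point 0ℓ → Set
  Closed K = InClosure K ⊆ K

  record LinearSubspace : Set₁ where
    field
      Member   : Pred Point 0ℓ
      respects : Member Respects _≈ᵥ_
      0-closed : 0ᵥ ∈ Member
      +-closed : ∀ {x y} → x ∈ Member → y ∈ Member → (x +ᵥ y) ∈ Member
      ·-closed : ∀ t {x} → x ∈ Member → (t · x) ∈ Member

  linearCombination : ∀ {k} → Vector Carrier k → Vector Point k → Point
  linearCombination c v j = sum (λ i → c i * v i j)

  LinearlyIndependent : ∀ {k} → Vector Point k → Set
  LinearlyIndependent v =
    ∀ c → linearCombination c v ≈ᵥ 0ᵥ → ∀ i → c i ≈ 0#

  Spans : ∀ {k} → Vector Point k → LinearSubspace → Set
  Spans v W = ∀ {x} → x ∈ LinearSubspace.Member W →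
              ∃ λ c → x ≈ᵥ linearCombination c v

  IsBasis : ∀ {k} → Vector Point k → LinearSubspace → Set
  IsBasis v W = (∀ i → v i ∈ LinearSubspace.Member W) ×
                LinearlyIndependent v × Spans v W

  -- The flat base + direction. Different base points may present the same
  -- flat, so flats are compared by _≋_, as sets of points.
  record AffineFlat : Set₁ where
    field
      base      : Point
      direction : LinearSubspace

    Points : Pred Point 0ℓ
    Points x = (x -ᵥ base) ∈ LinearSubspace.Member direction

  open AffineFlat public using (Points)

  _≋_ : Rel AffineFlat 0ℓ
  L ≋ L′ = Points L ≐ Points L′

  HasDim : AffineFlat → Pred ℕ 0ℓ
  HasDim L k = ∃ λ (v : Vector Point k) → IsBasis v (AffineFlat.direction L)

  IsDistFromOrigin : AffineFlat → Pred Carrier 0ℓ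
  IsDistFromOrigin L = IsInfimum (λ n → ∃ λ x → x ∈ Points L × IsNorm x n)

  -- Is-r L ρ is the graph of r : it says ρ = r(L). Truncated subtraction is
  -- harmless since dim L ≤ d.
  Is-r : AffineFlat → Pred (ℕ × Carrier) 0ℓ
  Is-r L (m , δ) = (∃ λ k → HasDim L k × m ≡ d ∸ k) × IsDistFromOrigin L δ

  _≤ₗₑₓ_ : Rel (ℕ × Carrier) 0ℓ
  _≤ₗₑₓ_ = ×-Lex _≡_ ℕ._<_ _≤_

  -- r(L) ≤ r(L′). The existential reading asserts that both values exist, so
  -- no comparison holds vacuously.
  _≤ᵣ_ : Rel AffineFlat 0ℓ
  L ≤ᵣ L′ = ∃₂ λ ρ ρ′ → Is-r L ρ × Is-r L′ ρ′ × ρ ≤ₗₑₓ ρ′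

  IsM : Pred Point 0ℓ → AffineFlat → Set₁
  IsM K L = Points L ⊆ K × (∀ L′ → Points L′ ⊆ K → L ≤ᵣ L′)

{-# OPTIONS --safe #-}
module Submission where

-- The direction of M(K) is the lineality space W of K, the set of u with K + ℝu = K.
-- Since K is closed and convex, the direction of every flat contained in K lies in W;
-- hence the flats of maximal dimension in K are exactly the translates x + W with x ∈ K.
-- Let q be the unique point of K closest to the origin. Then q + W is at distance ‖q‖,
-- the least possible, and a translate of W in K at the same distance, being closed and
-- convex, attains this distance at a point of K, which must be q.

open import Defs
open import Algebra.Solver.Ring.AlmostCommutativeRing
open import Axiom.ExcludedMiddle using (ExcludedMiddle)
open import Data.Empty using (⊥-elim)
open import Data.Fin.Base using (Fin; zero; suc; punchIn; punchOut)
open import Data.Fin.Properties as Fin using (punchIn-punchOut)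
open import Data.Integer.Base as ℤ using (ℤ; -[1+_])
import Data.Integer.Properties as ℤ
open import Data.Maybe.Base as Maybe using (Maybe)
open import Data.Nat.Base as ℕ using (ℕ; zero; suc)
import Data.Nat.Properties as ℕ
open import Data.Product using (∃!; ∃; _×_; _,_; proj₁; proj₂)
import Data.Sign.Base as Sign
open import Data.Sum.Base using (_⊎_; inj₁; inj₂)
open import Data.Vec.Functional using (Vector; _∷_; [])
open import Function.Base using (_∘_)
open import Level using (0ℓ)
open import Relation.Binary.Bundles using (Poset)
import Relation.Binary.Construct.NonStrictToStrict as ToStrict
open import Relation.Binary.PropositionalEquality as ≡ using (_≡_)
import Relation.Binary.Reasoning.PartialOrder as PartialOrderReasoning
open import Relation.Binary.Structures using (IsTotalOrder)
open import Relation.Nullary using (¬_; yes; no)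
open import Relation.Nullary.Decidable using (decidable-stable; dec⇒maybe)
open import Relation.Unary using (Pred; Satisfiable; _∈_; _⊆_; _≐_)

-- Ring solver with integer coefficients

-- Completeness is available only as suprema of sets, so no minimising sequence is formed: the
-- coordinates of the closest point are suprema. The parallelogram law drives the metric argument:
-- the midpoint of two nearly closest points of K lies in K and cannot be much shorter, so the two
-- points are close. With positive error this makes the limit exist; with zero error it gives
-- uniqueness.
--
-- Lines in K need limits as well: if a flat in K has direction u, segments from x to ever farther
-- points of the flat tilt towards the line x + ℝu, and closedness of K captures that line. For a
-- competitor with minimal r, equality of directions is then a dimension count: a subspace of W of
-- the same finite dimension is W.
--
-- Distance to a flat is an infimum, so equal distances alone say nothing about a common point. A
-- competitor must be shown to attain its distance, and its closedness is inherited from K once its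
-- direction is known to be W.

module IntegerCoefficients (ℝ : RealField) where

  open RealField ℝ
  open import Algebra.Properties.Ring ring
    using (-‿distribˡ-*; -‿distribʳ-*; -‿involutive; -‿+-comm; -0#≈0#)
  open import Algebra.Properties.Semiring.Mult.TCOptimised semiring
    using (1+×; ×-homo-+; ×1-homo-*) renaming (_×_ to _×ᵣ_)
  open import Relation.Binary.Reasoning.Setoid setoid

  -- The canonical ring homomorphism from the integers. The solver compares coefficients when
  -- normalising, and integer equality is decidable. Since `1 ×ᵣ 1#` reduces to `1#`, the law
  -- `1-homo` holds by `refl`.
  ⟦_⟧ : ℤ → Carrier
  ⟦ ℤ.+ n    ⟧ = n ×ᵣ 1#
  ⟦ -[1+ n ] ⟧ = - (suc n ×ᵣ 1#)

  ⟦⟧-⊖ : ∀ m n → ⟦ m ℤ.⊖ n ⟧ ≈ m ×ᵣ 1# - n ×ᵣ 1#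
  ⟦⟧-⊖ m       zero    = sym (trans (+-congˡ -0#≈0#) (+-identityʳ _))
  ⟦⟧-⊖ zero    (suc n) = sym (+-identityˡ _)
  ⟦⟧-⊖ (suc m) (suc n) = begin
    ⟦ suc m ℤ.⊖ suc n ⟧           ≡⟨ ≡.cong ⟦_⟧ (ℤ.[1+m]⊖[1+n]≡m⊖n m n) ⟩
    ⟦ m ℤ.⊖ n ⟧                   ≈⟨ ⟦⟧-⊖ m n ⟩
    M - N                         ≈⟨ +-congʳ (sym (trans (+-assoc M 1# (- 1#)) (trans (+-congˡ (-‿inverseʳ 1#)) (+-identityʳ M)))) ⟩
    (M + 1#) - 1# - N             ≈⟨ +-assoc _ _ _ ⟩
    (M + 1#) + (- 1# - N)         ≈⟨ +-cong (+-comm M 1#) (-‿+-comm 1# N) ⟩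
    (1# + M) - (1# + N)           ≈⟨ sym (+-cong (1+× m 1#) (-‿cong (1+× n 1#))) ⟩
    suc m ×ᵣ 1# - suc n ×ᵣ 1#     ∎
    where
    M = m ×ᵣ 1#
    N = n ×ᵣ 1#

  ⟦⟧-neg : ∀ i → ⟦ ℤ.- i ⟧ ≈ - ⟦ i ⟧
  ⟦⟧-neg (ℤ.+ zero)    = sym -0#≈0#
  ⟦⟧-neg (ℤ.+ (suc n)) = refl
  ⟦⟧-neg -[1+ n ]      = sym (-‿involutive _)

  ⟦⟧-+ : ∀ i j → ⟦ i ℤ.+ j ⟧ ≈ ⟦ i ⟧ + ⟦ j ⟧
  ⟦⟧-+ (ℤ.+ m)  (ℤ.+ n)  = ×-homo-+ 1# m n
  ⟦⟧-+ (ℤ.+ m)  -[1+ n ] = ⟦⟧-⊖ m (suc n)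
  ⟦⟧-+ -[1+ m ] (ℤ.+ n)  = trans (⟦⟧-⊖ n (suc m)) (+-comm _ _)
  ⟦⟧-+ -[1+ m ] -[1+ n ] = begin
    - (suc (suc (m ℕ.+ n)) ×ᵣ 1#)        ≡⟨ ≡.cong (λ k → - (k ×ᵣ 1#)) (≡.sym (ℕ.+-suc (suc m) n)) ⟩
    - ((suc m ℕ.+ suc n) ×ᵣ 1#)          ≈⟨ -‿cong (×-homo-+ 1# (suc m) (suc n)) ⟩
    - (suc m ×ᵣ 1# + suc n ×ᵣ 1#)        ≈⟨ sym (-‿+-comm _ _) ⟩
    - (suc m ×ᵣ 1#) + - (suc n ×ᵣ 1#)    ∎

  ⟦⟧-◃⁺ : ∀ n → ⟦ Sign.+ ℤ.◃ n ⟧ ≈ n ×ᵣ 1#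
  ⟦⟧-◃⁺ n = reflexive (≡.cong ⟦_⟧ (ℤ.+◃n≡+n n))

  ⟦⟧-◃⁻ : ∀ n → ⟦ Sign.- ℤ.◃ n ⟧ ≈ - (n ×ᵣ 1#)
  ⟦⟧-◃⁻ n = trans (reflexive (≡.cong ⟦_⟧ (ℤ.-◃n≡-n n))) (⟦⟧-neg (ℤ.+ n))

  ⟦⟧-* : ∀ i j → ⟦ i ℤ.* j ⟧ ≈ ⟦ i ⟧ * ⟦ j ⟧
  ⟦⟧-* (ℤ.+ m)  (ℤ.+ n)  = trans (⟦⟧-◃⁺ (m ℕ.* n)) (×1-homo-* m n)
  ⟦⟧-* (ℤ.+ m)  -[1+ n ] = trans (⟦⟧-◃⁻ (m ℕ.* suc n))
    (trans (-‿cong (×1-homo-* m (suc n))) (-‿distribʳ-* _ _))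
  ⟦⟧-* -[1+ m ] (ℤ.+ n)  = trans (⟦⟧-◃⁻ (suc m ℕ.* n))
    (trans (-‿cong (×1-homo-* (suc m) n)) (-‿distribˡ-* _ _))
  ⟦⟧-* -[1+ m ] -[1+ n ] = begin
    ⟦ Sign.+ ℤ.◃ (suc m ℕ.* suc n) ⟧     ≈⟨ ⟦⟧-◃⁺ (suc m ℕ.* suc n) ⟩
    (suc m ℕ.* suc n) ×ᵣ 1#              ≈⟨ ×1-homo-* (suc m) (suc n) ⟩
    M * N                                ≈⟨ sym (-‿involutive (M * N)) ⟩
    - - (M * N)                          ≈⟨ -‿cong (-‿distribˡ-* M N) ⟩
    - (- M * N)                          ≈⟨ -‿distribʳ-* (- M) N ⟩
    - M * - N                            ∎
    where
    M = suc m ×ᵣ 1#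
    N = suc n ×ᵣ 1#

  morphism : ℤ.+-*-rawRing -Raw-AlmostCommutative⟶ fromCommutativeRing commutativeRing
  morphism = record
    { ⟦_⟧    = ⟦_⟧
    ; +-homo = ⟦⟧-+
    ; *-homo = ⟦⟧-*
    ; -‿homo = ⟦⟧-neg
    ; 0-homo = refl
    ; 1-homo = refl
    }

  _≟_ : ∀ i j → Maybe (⟦ i ⟧ ≈ ⟦ j ⟧)
  i ≟ j = Maybe.map (reflexive ∘ ≡.cong ⟦_⟧) (dec⇒maybe (i ℤ.≟ j))

  open import Algebra.Solver.Ring ℤ.+-*-rawRing (fromCommutativeRing commutativeRing) morphism _≟_ public
    using (Polynomial; solve; _:=_; _:+_; _:*_; _:-_; :-_; con)

  :1 :2 : ∀ {n} → Polynomial n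
  :1 = con ℤ.1ℤ
  :2 = :1 :+ :1

-- Order, infima and square roots

module RealProperties (em : ExcludedMiddle 0ℓ) (ℝ : RealField) where

  open RealField ℝ
  open IsTotalOrder isTotalOrder public using (isPartialOrder; total; antisym)
    renaming (reflexive to ≤-reflexive; refl to ≤-refl; trans to ≤-trans)
  open IntegerCoefficients ℝ public using (solve; _:=_; _:+_; _:*_; _:-_; :-_; :1; :2)

  poset : Poset 0ℓ 0ℓ 0ℓ
  poset = record { isPartialOrder = isPartialOrder }

  open PartialOrderReasoning poset

  <⇒≤ : ∀ {x y} → x < y → x ≤ y
  <⇒≤ = proj₁

  <⇒≱ : ∀ {x y} → x < y → ¬ (y ≤ x)
  <⇒≱ = ToStrict.<⇒≱ _≈_ _≤_ antisym

  ≰⇒> : ∀ {x y} → ¬ (x ≤ y) → y < x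
  ≰⇒> = ToStrict.≰⇒> _≈_ _≤_ sym ≤-reflexive total

  ≮⇒≥ : ∀ {x y} → ¬ (x < y) → y ≤ x
  ≮⇒≥ = ToStrict.≮⇒≥ _≈_ _≤_ sym (λ _ _ → em) ≤-reflexive total

  2# : Carrier
  2# = 1# + 1#

  abstract

    x≤y⇒0≤y-x : ∀ {x y} → x ≤ y → 0# ≤ y - x
    x≤y⇒0≤y-x {x} {y} x≤y = begin
      0#     ≈⟨ sym (-‿inverseʳ x) ⟩
      x - x  ≤⟨ +-monoˡ-≤ (- x) x≤y ⟩
      y - x  ∎

    0≤y-x⇒x≤y : ∀ {x y} → 0# ≤ y - x → x ≤ y
    0≤y-x⇒x≤y {x} {y} 0≤y-x = begin
      x          ≈⟨ sym (+-identityˡ x) ⟩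
      0# + x     ≤⟨ +-monoˡ-≤ x 0≤y-x ⟩
      y - x + x  ≈⟨ solve 2 (λ x y → y :- x :+ x := y) refl x y ⟩
      y          ∎

    x<y⇒0<y-x : ∀ {x y} → x < y → 0# < y - x
    x<y⇒0<y-x {x} {y} (x≤y , x≉y) = x≤y⇒0≤y-x x≤y , λ 0≈y-x →
      x≉y (trans (sym (+-identityˡ x))
        (trans (+-congʳ 0≈y-x) (solve 2 (λ x y → y :- x :+ x := y) refl x y)))

    x+[y-x]≈y : ∀ x y → x + (y - x) ≈ y
    x+[y-x]≈y = solve 2 (λ x y → x :+ (y :- x) := y) refl

    x+z≤y⇒x≤y-z : ∀ {x y z} → x + z ≤ y → x ≤ y - z
    x+z≤y⇒x≤y-z {x} {y} {z} x+z≤y = begin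
      x          ≈⟨ solve 2 (λ x z → x := x :+ z :- z) refl x z ⟩
      x + z - z  ≤⟨ +-monoˡ-≤ (- z) x+z≤y ⟩
      y - z      ∎

    x≤y-z⇒x+z≤y : ∀ {x y z} → x ≤ y - z → x + z ≤ y
    x≤y-z⇒x+z≤y {x} {y} {z} x≤y-z = begin
      x + z      ≤⟨ +-monoˡ-≤ z x≤y-z ⟩
      y - z + z  ≈⟨ solve 2 (λ y z → y :- z :+ z := y) refl y z ⟩
      y          ∎

    +-monoʳ-≤ : ∀ z {x y} → x ≤ y → z + x ≤ z + y
    +-monoʳ-≤ z {x} {y} x≤y = begin
      z + x  ≈⟨ +-comm z x ⟩
      x + z  ≤⟨ +-monoˡ-≤ z x≤y ⟩
      y + z  ≈⟨ +-comm y z ⟩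
      z + y  ∎

    +-mono-≤ : ∀ {x y u v} → x ≤ y → u ≤ v → x + u ≤ y + v
    +-mono-≤ {y = y} {u} x≤y u≤v = ≤-trans (+-monoˡ-≤ u x≤y) (+-monoʳ-≤ y u≤v)

    +-monoʳ-< : ∀ z {x y} → x < y → z + x < z + y
    +-monoʳ-< z {x} {y} x<y = +-monoʳ-≤ z (<⇒≤ x<y) , λ z+x≈z+y →
      proj₂ x<y (begin-equality
        x            ≈⟨ solve 2 (λ x z → x := :- z :+ (z :+ x)) refl x z ⟩
        - z + (z + x) ≈⟨ +-congˡ z+x≈z+y ⟩
        - z + (z + y) ≈⟨ solve 2 (λ x z → :- z :+ (z :+ x) := x) refl y z ⟩
        y            ∎)

    +-nonNeg : ∀ {x y} → 0# ≤ x → 0# ≤ y → 0# ≤ x + y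
    +-nonNeg 0≤x 0≤y = ≤-trans (≤-reflexive (sym (+-identityˡ 0#))) (+-mono-≤ 0≤x 0≤y)

    x<x+y : ∀ x {y} → 0# < y → x < x + y
    x<x+y x {y} 0<y = begin-strict
      x       ≈⟨ sym (+-identityʳ x) ⟩
      x + 0#  <⟨ +-monoʳ-< x 0<y ⟩
      x + y   ∎

    x≤x+y : ∀ x {y} → 0# ≤ y → x ≤ x + y
    x≤x+y x {y} 0≤y = begin
      x       ≈⟨ sym (+-identityʳ x) ⟩
      x + 0#  ≤⟨ +-monoʳ-≤ x 0≤y ⟩
      x + y   ∎

    +-nonNeg-pos : ∀ {x y} → 0# ≤ x → 0# < y → 0# < x + y
    +-nonNeg-pos {x} {y} 0≤x 0<y = begin-strict
      0#      ≤⟨ 0≤x ⟩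
      x       <⟨ x<x+y x 0<y ⟩
      x + y   ∎

    *-monoˡ-≤ : ∀ {z x y} → 0# ≤ z → x ≤ y → z * x ≤ z * y
    *-monoˡ-≤ {z} {x} {y} 0≤z x≤y = 0≤y-x⇒x≤y (begin
      0#             ≤⟨ *-nonNeg 0≤z (x≤y⇒0≤y-x x≤y) ⟩
      z * (y - x)    ≈⟨ solve 3 (λ x y z → z :* (y :- x) := z :* y :- z :* x) refl x y z ⟩
      z * y - z * x  ∎)

    *-mono-≤ : ∀ {x y u v} → 0# ≤ x → x ≤ y → 0# ≤ u → u ≤ v → x * u ≤ y * v
    *-mono-≤ {x} {y} {u} {v} 0≤x x≤y 0≤u u≤v = begin
      x * u  ≤⟨ *-monoˡ-≤ 0≤x u≤v ⟩
      x * v  ≈⟨ *-comm x v ⟩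
      v * x  ≤⟨ *-monoˡ-≤ (≤-trans 0≤u u≤v) x≤y ⟩
      v * y  ≈⟨ *-comm v y ⟩
      y * v  ∎

    *-cancelˡ-≈0 : ∀ {x y} → ¬ (x ≈ 0#) → x * y ≈ 0# → y ≈ 0#
    *-cancelˡ-≈0 {x} {y} x≉0 xy≈0 with inverse x x≉0
    ... | x⁻¹ , xx⁻¹≈1 = begin-equality
      y              ≈⟨ sym (*-identityˡ y) ⟩
      1# * y         ≈⟨ *-congʳ (sym xx⁻¹≈1) ⟩
      x * x⁻¹ * y    ≈⟨ solve 3 (λ x y z → x :* z :* y := z :* (x :* y)) refl x y x⁻¹ ⟩
      x⁻¹ * (x * y)  ≈⟨ *-congˡ xy≈0 ⟩
      x⁻¹ * 0#       ≈⟨ zeroʳ x⁻¹ ⟩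
      0#             ∎

    *-pos : ∀ {x y} → 0# < x → 0# < y → 0# < x * y
    *-pos (0≤x , 0≉x) (0≤y , 0≉y) =
      *-nonNeg 0≤x 0≤y , λ 0≈xy → 0≉y (sym (*-cancelˡ-≈0 (0≉x ∘ sym) (sym 0≈xy)))

    *-monoˡ-< : ∀ {z x y} → 0# < z → x < y → z * x < z * y
    *-monoˡ-< {z} {x} {y} 0<z x<y = begin-strict
      z * x                  <⟨ x<x+y (z * x) (*-pos 0<z (x<y⇒0<y-x x<y)) ⟩
      z * x + z * (y - x)    ≈⟨ solve 3 (λ x y z → z :* x :+ z :* (y :- x) := z :* y) refl x y z ⟩
      z * y                  ∎

    *-cancelˡ-≤ : ∀ {z x y} → 0# < z → z * x ≤ z * y → x ≤ y
    *-cancelˡ-≤ 0<z zx≤zy = ≮⇒≥ (λ y<x → <⇒≱ (*-monoˡ-< 0<z y<x) zx≤zy)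

    x*x-nonNeg : ∀ x → 0# ≤ x * x
    x*x-nonNeg x with total 0# x
    ... | inj₁ 0≤x = *-nonNeg 0≤x 0≤x
    ... | inj₂ x≤0 = begin
      0#           ≤⟨ *-nonNeg 0≤-x 0≤-x ⟩
      - x * - x    ≈⟨ solve 1 (λ x → :- x :* :- x := x :* x) refl x ⟩
      x * x        ∎
      where
      0≤-x : 0# ≤ - x
      0≤-x = ≤-trans (x≤y⇒0≤y-x x≤0) (≤-reflexive (+-identityˡ (- x)))

    0<1 : 0# < 1#
    0<1 = ≤-trans (x*x-nonNeg 1#) (≤-reflexive (*-identityˡ 1#)) , 1≉0 ∘ sym

    0≤1 : 0# ≤ 1#
    0≤1 = <⇒≤ 0<1

    0<2 : 0# < 2#
    0<2 = +-nonNeg-pos 0≤1 0<1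

    x*x≈0⇒x≈0 : ∀ {x} → x * x ≈ 0# → x ≈ 0#
    x*x≈0⇒x≈0 {x} xx≈0 = decidable-stable em (λ x≉0 → x≉0 (*-cancelˡ-≈0 x≉0 xx≈0))

    *-self-mono-< : ∀ {x y} → 0# ≤ x → x < y → x * x < y * y
    *-self-mono-< {x} {y} 0≤x x<y = begin-strict
      x * x  ≤⟨ *-monoˡ-≤ 0≤x (<⇒≤ x<y) ⟩
      x * y  ≈⟨ *-comm x y ⟩
      y * x  <⟨ *-monoˡ-< 0<y x<y ⟩
      y * y  ∎
      where
      0<y : 0# < y
      0<y = begin-strict
        0#  ≤⟨ 0≤x ⟩
        x   <⟨ x<y ⟩
        y   ∎

    *-self-cancel-≤ : ∀ {x y} → 0# ≤ y → x * x ≤ y * y → x ≤ y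
    *-self-cancel-≤ 0≤y xx≤yy = ≮⇒≥ (λ y<x → <⇒≱ (*-self-mono-< 0≤y y<x) xx≤yy)

    *-self-cancel-< : ∀ {x y} → 0# ≤ y → x * x < y * y → x < y
    *-self-cancel-< 0≤y xx<yy =
      *-self-cancel-≤ 0≤y (<⇒≤ xx<yy) , λ x≈y → proj₂ xx<yy (*-cong x≈y x≈y)

    -- Passage to the limit in an inequality: if `y < x`, then `ε = x - y` would give `x < x`.
    x≤y+ε⇒x≤y : ∀ {x y} → (∀ {ε} → 0# < ε → x < y + ε) → x ≤ y
    x≤y+ε⇒x≤y {x} {y} x<y+ε = ≮⇒≥ λ y<x → proj₂ (x<y+ε (x<y⇒0<y-x y<x))
      (solve 2 (λ x y → x := y :+ (x :- y)) refl x y)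

    -- Bounds the set whose supremum is the square root; `a + 1#` serves small and large `a` alike,
    -- since `a ≤ (a + 1)²`.
    x*x≤a⇒x≤a+1 : ∀ {x a} → 0# ≤ a → x * x ≤ a → x ≤ a + 1#
    x*x≤a⇒x≤a+1 {x} {a} 0≤a xx≤a = *-self-cancel-≤ (+-nonNeg 0≤a 0≤1) (begin
      x * x                      ≤⟨ xx≤a ⟩
      a                          ≤⟨ x≤x+y a (+-nonNeg (x*x-nonNeg a) (+-nonNeg 0≤a 0≤1)) ⟩
      a + (a * a + (a + 1#))     ≈⟨ solve 1 (λ a → a :+ (a :* a :+ (a :+ :1)) := (a :+ :1) :* (a :+ :1)) refl a ⟩
      (a + 1#) * (a + 1#)        ∎)

  abstract

    -- The witness is ε / (c + (1 + ε)).
    small-multiple : ∀ {ε c} → 0# < ε → 0# ≤ c → ∃ λ t → 0# < t × t ≤ 1# × t * c < ε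
    small-multiple {ε} {c} 0<ε 0≤c = let D⁻¹ , DD⁻¹≈1 = inverse D (proj₂ 0<D ∘ sym) in
      D⁻¹ * ε , bounds (trans (sym (*-assoc D D⁻¹ ε)) (trans (*-congʳ DD⁻¹≈1) (*-identityˡ ε)))
      where
      D : Carrier
      D = c + (1# + ε)
      0<D : 0# < D
      0<D = +-nonNeg-pos 0≤c (+-nonNeg-pos 0≤1 0<ε)
      bounds : ∀ {t} → D * t ≈ ε → 0# < t × t ≤ 1# × t * c < ε
      bounds {t} Dt≈ε = 0<t , t≤1 , tc<ε
        where
        0<t : 0# < t
        0<t = ≰⇒> λ t≤0 → <⇒≱ 0<ε (begin
          ε       ≈⟨ sym Dt≈ε ⟩
          D * t   ≤⟨ *-monoˡ-≤ (<⇒≤ 0<D) t≤0 ⟩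
          D * 0#  ≈⟨ zeroʳ D ⟩
          0#      ∎)
        t≤1 : t ≤ 1#
        t≤1 = *-cancelˡ-≤ 0<D (begin
          D * t          ≈⟨ Dt≈ε ⟩
          ε              ≤⟨ x≤x+y ε (+-nonNeg 0≤c 0≤1) ⟩
          ε + (c + 1#)   ≈⟨ solve 2 (λ c ε → ε :+ (c :+ :1) := (c :+ (:1 :+ ε)) :* :1) refl c ε ⟩
          D * 1#         ∎)
        tc<ε : t * c < ε
        tc<ε = begin-strict
          t * c                   <⟨ x<x+y (t * c) (+-nonNeg-pos (<⇒≤ 0<t) (*-pos 0<t 0<ε)) ⟩
          t * c + (t + t * ε)     ≈⟨ solve 3 (λ c ε t → t :* c :+ (t :+ t :* ε) := (c :+ (:1 :+ ε)) :* t) refl c ε t ⟩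
          D * t                   ≈⟨ Dt≈ε ⟩
          ε                       ∎

  -- The supremum of the lower bounds is the greatest lower bound: each element of `S` bounds the
  -- lower bounds from above.
  infimum : (S : Pred Carrier 0ℓ) → Satisfiable S → Satisfiable (LowerBound S) →
            Satisfiable (IsInfimum S)
  infimum S (x , x∈S) bounded with complete (LowerBound S) bounded (x , λ b → b x∈S)
  ... | s , upper , least = s , (λ y∈S → least (λ b → b y∈S)) , upper

  abstract

    -- If `s * s < a`, some `s + t` with `t > 0` still belongs to the set; if `a < s * s`, some
    -- `s - t` is already an upper bound. Both come from one estimate of `(x + t)²`.
    sup-squares≤ : ∀ {a s} → 0# ≤ a → IsSupremum (λ x → 0# ≤ x × x * x ≤ a) s →
                   0# ≤ s × s * s ≈ a
    sup-squares≤ {a} {s} 0≤a (upper , least) = 0≤s , antisym (≮⇒≥ a≮ss) (≮⇒≥ ss≮a)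
      where
      0≤s : 0# ≤ s
      0≤s = upper (≤-refl , ≤-trans (≤-reflexive (zeroˡ 0#)) 0≤a)

      -- Bounds `t + 2x` whenever `x ≤ s` and `t ≤ 1`, so that the increment `t * (t + 2x)` is at
      -- most linear in `t`.
      c : Carrier
      c = 1# + 2# * s

      0≤c : 0# ≤ c
      0≤c = +-nonNeg 0≤1 (*-nonNeg (<⇒≤ 0<2) 0≤s)

      [x+t]²≤x²+tc : ∀ {x t} → x ≤ s → 0# ≤ t → t ≤ 1# → (x + t) * (x + t) ≤ x * x + t * c
      [x+t]²≤x²+tc {x} {t} x≤s 0≤t t≤1 = begin
        (x + t) * (x + t)          ≈⟨ solve 2 (λ x t → (x :+ t) :* (x :+ t) := x :* x :+ t :* (t :+ :2 :* x)) refl x t ⟩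
        x * x + t * (t + 2# * x)   ≤⟨ +-monoʳ-≤ _ (*-monoˡ-≤ 0≤t (+-mono-≤ t≤1 (*-monoˡ-≤ (<⇒≤ 0<2) x≤s))) ⟩
        x * x + t * c              ∎

      ss≮a : ¬ (s * s < a)
      ss≮a ss<a = let t , 0<t , t≤1 , tc<a-ss = small-multiple (x<y⇒0<y-x ss<a) 0≤c in
        <⇒≱ (x<x+y s 0<t) (upper (+-nonNeg 0≤s (<⇒≤ 0<t) , (begin
          (s + t) * (s + t)      ≤⟨ [x+t]²≤x²+tc ≤-refl (<⇒≤ 0<t) t≤1 ⟩
          s * s + t * c          ≤⟨ +-monoʳ-≤ (s * s) (<⇒≤ tc<a-ss) ⟩
          s * s + (a - s * s)    ≈⟨ x+[y-x]≈y (s * s) a ⟩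
          a                      ∎)))

      a≮ss : ¬ (a < s * s)
      a≮ss a<ss = let t , 0<t , t≤1 , tc<ss-a = small-multiple (x<y⇒0<y-x a<ss) 0≤c in
        <⇒≱ (x<x+y s 0<t) (x≤y-z⇒x+z≤y (least (λ {x} (0≤x , xx≤a) →
          x+z≤y⇒x≤y-z (*-self-cancel-≤ 0≤s (begin
            (x + t) * (x + t)      ≤⟨ [x+t]²≤x²+tc (upper (0≤x , xx≤a)) (<⇒≤ 0<t) t≤1 ⟩
            x * x + t * c          ≤⟨ +-mono-≤ xx≤a (<⇒≤ tc<ss-a) ⟩
            a + (s * s - a)        ≈⟨ x+[y-x]≈y a (s * s) ⟩
            s * s                  ∎)))))

    sqrt : ∀ {a} → 0# ≤ a → ∃ λ s → 0# ≤ s × s * s ≈ a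
    sqrt {a} 0≤a = let s , isSup = complete (λ x → 0# ≤ x × x * x ≤ a)
                         (0# , ≤-refl , ≤-trans (≤-reflexive (zeroˡ 0#)) 0≤a)
                         (a + 1# , λ (_ , xx≤a) → x*x≤a⇒x≤a+1 0≤a xx≤a)
                   in s , sup-squares≤ 0≤a isSup

-- Linear independence and bases

module LinearAlgebra (em : ExcludedMiddle 0ℓ) (ℝ : RealField) (d : ℕ) where

  open RealField ℝ hiding (zero)
  open RealProperties em ℝ
  open Euclidean ℝ d
  open import Algebra.Properties.Semiring.Sum semiring
    using (sum-cong-≋; sum-replicate-zero; ∑-distrib-+; ∑-comm; *-distribˡ-sum; *-distribʳ-sum)
  open import Relation.Binary.Reasoning.Setoid setoid

  InSpan : ∀ {k} → Vector Point k → Pred Point 0ℓ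
  InSpan v x = ∃ λ c → x ≈ᵥ linearCombination c v

  sum-≈0 : ∀ {n} {f : Vector Carrier n} → (∀ i → f i ≈ 0#) → sum f ≈ 0#
  sum-≈0 {n} f≈0 = trans (sum-cong-≋ f≈0) (sum-replicate-zero n)

  -- Subtracting r i times the first row from row i of the remaining matrix.
  elimination : ∀ {k} (a r b : Vector Carrier k) c →
                - sum (λ i → a i * r i) * c + sum (λ i → a i * b i) ≈
                sum (λ i → a i * (b i - r i * c))
  elimination a r b c = begin
    - S * c + T                                            ≈⟨ solve 3 (λ s c t → :- s :* c :+ t := t :+ (:- c) :* s) refl S c T ⟩
    T + - c * S                                            ≈⟨ +-congˡ (*-distribˡ-sum (- c) (λ i → a i * r i)) ⟩
    T + sum (λ i → - c * (a i * r i))                      ≈⟨ sym (∑-distrib-+ (λ i → a i * b i) (λ i → - c * (a i * r i))) ⟩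
    sum (λ i → a i * b i + - c * (a i * r i))              ≈⟨ sum-cong-≋ (λ i → solve 4 (λ a r b c → a :* b :+ :- c :* (a :* r) := a :* (b :- r :* c)) refl (a i) (r i) (b i) c) ⟩
    sum (λ i → a i * (b i - r i * c))                      ∎
    where
    S = sum (λ i → a i * r i)
    T = sum (λ i → a i * b i)

  -- Gaussian elimination, by induction on the number of columns. A zero first row is a relation by
  -- itself. Otherwise a pivot in column `j` clears that column from the other rows; a relation
  -- among the reduced rows, with column `j` deleted, lifts once the first row gets the coefficient
  -- dictated by `elimination`.
  dependent-rows : ∀ {k m} → m ℕ.< k → (C : Fin k → Fin m → Carrier) →
                   ∃ λ (a : Vector Carrier k) → (∃ λ i → ¬ (a i ≈ 0#)) ×
                   (∀ j → sum (λ i → a i * C i j) ≈ 0#)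
  dependent-rows {suc k} {zero}  _           C = (λ _ → 1#) , (zero , 1≉0) , λ ()
  dependent-rows {suc k} {suc m} (ℕ.s≤s m<k) C with em {P = ∃ λ j → ¬ (C zero j ≈ 0#)}
  ... | no ∄pivot = (1# ∷ λ _ → 0#) , (zero , 1≉0) , λ j → begin
      1# * C zero j + sum (λ i → 0# * C (suc i) j)  ≈⟨ +-cong (*-identityˡ _) (sum-≈0 (λ i → zeroˡ (C (suc i) j))) ⟩
      C zero j + 0#                                 ≈⟨ +-identityʳ _ ⟩
      C zero j                                      ≈⟨ decidable-stable em (λ C₀ⱼ≉0 → ∄pivot (j , C₀ⱼ≉0)) ⟩
      0#                                            ∎
  ... | yes (j , p≉0) =
    let p⁻¹ , pp⁻¹≈1    = inverse (C zero j) p≉0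
        r i             = C (suc i) j * p⁻¹
        a , (i , aᵢ≉0) , aC′≈0 = dependent-rows m<k
          (λ i l → C (suc i) (punchIn j l) - r i * C zero (punchIn j l))
    in (- sum (λ i → a i * r i) ∷ a) , (suc i , aᵢ≉0) , λ l →
       trans (elimination a r (λ i → C (suc i) l) (C zero l))
             (column a pp⁻¹≈1 aC′≈0 l)
    where
    -- The recursive relation covers the columns other than `j`, reached through `punchIn`; in
    -- column `j` every reduced entry vanishes because `q` inverts the pivot.
    column : ∀ a {q} → C zero j * q ≈ 1# →
             (∀ l → sum (λ i → a i * (C (suc i) (punchIn j l) - C (suc i) j * q * C zero (punchIn j l))) ≈ 0#) →
             ∀ l → sum (λ i → a i * (C (suc i) l - C (suc i) j * q * C zero l)) ≈ 0#
    column a {q} pq≈1 aC′≈0 l with j Fin.≟ l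
    ... | no j≢l = ≡.subst (λ l → sum (λ i → a i * (C (suc i) l - C (suc i) j * q * C zero l)) ≈ 0#)
                     (punchIn-punchOut j≢l) (aC′≈0 (punchOut j≢l))
    ... | yes ≡.refl = sum-≈0 λ i → begin
      a i * (C (suc i) j - C (suc i) j * q * C zero j)    ≈⟨ solve 4 (λ a x q p → a :* (x :- x :* q :* p) := a :* x :* (:1 :- p :* q)) refl (a i) (C (suc i) j) q (C zero j) ⟩
      a i * C (suc i) j * (1# - C zero j * q)             ≈⟨ *-congˡ (trans (+-congˡ (-‿cong pq≈1)) (-‿inverseʳ 1#)) ⟩
      a i * C (suc i) j * 0#                              ≈⟨ zeroʳ _ ⟩
      0#                                                  ∎

  linearCombination-assoc : ∀ {k m} (a : Vector Carrier k) (C : Fin k → Fin m → Carrier) (v : Vector Point m) →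
    linearCombination a (λ i → linearCombination (C i) v) ≈ᵥ
    linearCombination (λ l → sum (λ i → a i * C i l)) v
  linearCombination-assoc a C v j = begin
    sum (λ i → a i * sum (λ l → C i l * v l j))      ≈⟨ sum-cong-≋ (λ i → *-distribˡ-sum (a i) (λ l → C i l * v l j)) ⟩
    sum (λ i → sum (λ l → a i * (C i l * v l j)))    ≈⟨ ∑-comm (λ i l → a i * (C i l * v l j)) ⟩
    sum (λ l → sum (λ i → a i * (C i l * v l j)))    ≈⟨ sum-cong-≋ (λ l → sum-cong-≋ (λ i → sym (*-assoc (a i) (C i l) (v l j)))) ⟩
    sum (λ l → sum (λ i → a i * C i l * v l j))      ≈⟨ sum-cong-≋ (λ l → sym (*-distribʳ-sum (v l j) (λ i → a i * C i l))) ⟩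
    sum (λ l → sum (λ i → a i * C i l) * v l j)      ∎

  -- The points are themselves the rows of a matrix with `d` columns.
  independent⇒≤dim : ∀ {k} {u : Vector Point k} → LinearlyIndependent u → k ℕ.≤ d
  independent⇒≤dim {u = u} independent = ℕ.≮⇒≥ λ d<k →
    let a , (i , aᵢ≉0) , au≈0 = dependent-rows d<k u in aᵢ≉0 (independent a au≈0 i)

  -- The coefficients expressing `u` over `v` form a matrix with `k` rows and `m` columns; a
  -- relation among its rows is a relation among the `u i`.
  steinitz : ∀ {k m} {u : Vector Point k} {v : Vector Point m} →
             LinearlyIndependent u → (∀ i → InSpan v (u i)) → k ℕ.≤ m
  steinitz {u = u} {v} independent u∈span = ℕ.≮⇒≥ λ m<k →
    let a , (i , aᵢ≉0) , aC≈0 = dependent-rows m<k C in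
    aᵢ≉0 (independent a (λ j → begin
      linearCombination a u j                                 ≈⟨ sum-cong-≋ (λ i → *-congˡ (proj₂ (u∈span i) j)) ⟩
      linearCombination a (λ i → linearCombination (C i) v) j ≈⟨ linearCombination-assoc a C v j ⟩
      linearCombination (λ l → sum (λ i → a i * C i l)) v j   ≈⟨ sum-≈0 (λ l → trans (*-congʳ (aC≈0 l)) (zeroˡ (v l j))) ⟩
      0#                                                      ∎) i)
    where
    C = λ i → proj₁ (u∈span i)

  independent-∷ : ∀ {k w} {v : Vector Point k} → LinearlyIndependent v → ¬ InSpan v w →
                  LinearlyIndependent (w ∷ v)
  independent-∷ {k} {w} {v} independent w∉span c cwv≈0 = c≈0
    where
    -- With a nonzero, hence invertible, coefficient the relation could be solved for `w`, placing
    -- it in the span of `v`.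
    head≈0 : c zero ≈ 0#
    head≈0 = decidable-stable em λ c₀≉0 → let e , c₀e≈1 = inverse (c zero) c₀≉0 in
      w∉span ((λ i → - e * c (suc i)) , λ j → let S = sum (λ i → c (suc i) * v i j) in begin
        w j                                       ≈⟨ solve 4 (λ w c e s → w := e :* (c :* w :+ s) :+ :- e :* s :+ w :* (:1 :- c :* e)) refl (w j) (c zero) e S ⟩
        e * (c zero * w j + S) + - e * S + w j * (1# - c zero * e)
                                                  ≈⟨ +-cong (+-congʳ (trans (*-congˡ (cwv≈0 j)) (zeroʳ e)))
                                                       (trans (*-congˡ (trans (+-congˡ (-‿cong c₀e≈1)) (-‿inverseʳ 1#))) (zeroʳ (w j))) ⟩
        0# + - e * S + 0#                         ≈⟨ trans (+-identityʳ _) (+-identityˡ _) ⟩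
        - e * S                                   ≈⟨ *-distribˡ-sum (- e) (λ i → c (suc i) * v i j) ⟩
        sum (λ i → - e * (c (suc i) * v i j))     ≈⟨ sum-cong-≋ (λ i → sym (*-assoc (- e) (c (suc i)) (v i j))) ⟩
        sum (λ i → - e * c (suc i) * v i j)       ∎)

    c≈0 : ∀ i → c i ≈ 0#
    c≈0 zero    = head≈0
    c≈0 (suc i) = independent (c ∘ suc) (λ j → begin
      sum (λ i → c (suc i) * v i j)                       ≈⟨ sym (+-identityˡ _) ⟩
      0# + sum (λ i → c (suc i) * v i j)                  ≈⟨ +-congʳ (sym (trans (*-congʳ head≈0) (zeroˡ (w j)))) ⟩
      c zero * w j + sum (λ i → c (suc i) * v i j)        ≈⟨ cwv≈0 j ⟩
      0#                                                  ∎) i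

  ∷-members : ∀ {k w} {v : Vector Point k} (P : Pred Point 0ℓ) →
              w ∈ P → (∀ i → v i ∈ P) → ∀ i → (w ∷ v) i ∈ P
  ∷-members P w∈P v∈P zero    = w∈P
  ∷-members P w∈P v∈P (suc i) = v∈P i

  linearCombination-closed : ∀ (W : LinearSubspace) {k} (c : Vector Carrier k) {v : Vector Point k} →
    (∀ i → v i ∈ LinearSubspace.Member W) → linearCombination c v ∈ LinearSubspace.Member W
  linearCombination-closed W {zero}  c v∈W = LinearSubspace.0-closed W
  linearCombination-closed W {suc k} c v∈W = LinearSubspace.+-closed W
    (LinearSubspace.·-closed W (c zero) (v∈W zero))
    (linearCombination-closed W (c ∘ suc) (v∈W ∘ suc))

  -- An independent family in `W` that cannot be extended spans `W`; excluded middle decides whether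
  -- it can. The first argument of `extend` is fuel: `d < n + k` is preserved, so exhausting it
  -- would leave more than `d` independent points.
  basis : (W : LinearSubspace) → ∃ λ k → ∃ λ (v : Vector Point k) → IsBasis v W
  basis W = extend (suc d) [] (λ ()) (λ _ _ ()) (ℕ.m≤m+n (suc d) 0)
    where
    open LinearSubspace W
    extend : ∀ n {k} (v : Vector Point k) → (∀ i → v i ∈ Member) → LinearlyIndependent v →
             d ℕ.< n ℕ.+ k → ∃ λ k → ∃ λ (v : Vector Point k) → IsBasis v W
    extend zero    v v∈W independent d<k = ⊥-elim (ℕ.<⇒≱ d<k (independent⇒≤dim independent))
    extend (suc n) {k} v v∈W independent d<1+n+k with em {P = ∃ λ w → w ∈ Member × ¬ InSpan v w}
    ... | yes (w , w∈W , w∉span) = extend n (w ∷ v) (∷-members Member w∈W v∈W)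
            (independent-∷ independent w∉span) (≡.subst (d ℕ.<_) (≡.sym (ℕ.+-suc n k)) d<1+n+k)
    ... | no ∄w = k , v , v∈W , independent ,
            λ {x} x∈W → decidable-stable em (λ x∉span → ∄w (x , x∈W , x∉span))

  module _ {W W′ : LinearSubspace} (W′⊆W : LinearSubspace.Member W′ ⊆ LinearSubspace.Member W) where

    dim-mono : ∀ {k k′} {v : Vector Point k} {v′ : Vector Point k′} →
               IsBasis v W → IsBasis v′ W′ → k′ ℕ.≤ k
    dim-mono (_ , _ , spans) (v′∈W′ , independent , _) =
      steinitz independent (λ i → spans (W′⊆W (v′∈W′ i)))

    -- A point of `W` outside `W′` could be prepended to the basis of `W′`, giving `k + 1`
    -- independent points in the span of `k`.
    equal-dim⇒⊇ : ∀ {k} {v v′ : Vector Point k} → IsBasis v W → IsBasis v′ W′ →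
                  LinearSubspace.Member W ⊆ LinearSubspace.Member W′
    equal-dim⇒⊇ (_ , _ , spans) (v′∈W′ , independent , _) {w} w∈W =
      decidable-stable em λ w∉W′ → ℕ.1+n≰n (steinitz
        (independent-∷ independent λ (c , w≈cv′) → w∉W′
          (LinearSubspace.respects W′ (λ i → sym (w≈cv′ i)) (linearCombination-closed W′ c v′∈W′)))
        (∷-members (InSpan _) (spans w∈W) (λ i → spans (W′⊆W (v′∈W′ i)))))

-- The point of a closed convex set closest to the origin

module ClosestPoint (em : ExcludedMiddle 0ℓ) (ℝ : RealField) (d : ℕ) where

  open RealField ℝ hiding (zero)
  open RealProperties em ℝ
  open Euclidean ℝ d
  open import Algebra.Properties.Semiring.Sum semiring
    using (sum-cong-≋; sum-replicate-zero; ∑-distrib-+; *-distribˡ-sum)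
  open PartialOrderReasoning poset

  abstract

    sum-mono-≤ : ∀ {n} {f g : Vector Carrier n} → (∀ i → f i ≤ g i) → sum f ≤ sum g
    sum-mono-≤ {zero}  f≤g = ≤-refl
    sum-mono-≤ {suc n} f≤g = +-mono-≤ (f≤g zero) (sum-mono-≤ (f≤g ∘ suc))

    sum-nonNeg : ∀ {n} {f : Vector Carrier n} → (∀ i → 0# ≤ f i) → 0# ≤ sum f
    sum-nonNeg {n} 0≤f = ≤-trans (≤-reflexive (sym (sum-replicate-zero n))) (sum-mono-≤ 0≤f)

    term≤sum : ∀ {n} {f : Vector Carrier n} → (∀ i → 0# ≤ f i) → ∀ i → f i ≤ sum f
    term≤sum 0≤f zero = x≤x+y _ (sum-nonNeg (0≤f ∘ suc))
    term≤sum {suc n} {f} 0≤f (suc i) = begin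
      f (suc i)        ≤⟨ term≤sum (0≤f ∘ suc) i ⟩
      sum (f ∘ suc)    ≤⟨ x≤x+y _ (0≤f zero) ⟩
      sum (f ∘ suc) + f zero  ≈⟨ +-comm _ _ ⟩
      sum f            ∎

    sum-linear : ∀ {n} α β (f g : Vector Carrier n) →
                 sum (λ i → α * f i + β * g i) ≈ α * sum f + β * sum g
    sum-linear α β f g = trans (∑-distrib-+ (λ i → α * f i) (λ i → β * g i))
      (+-cong (sym (*-distribˡ-sum α f)) (sym (*-distribˡ-sum β g)))

  -- Squared norms are polynomial in the coordinates, so identities about them reduce to the ring
  -- solver; square roots enter only where norms themselves are required.
  ‖_‖² : Point → Carrier
  ‖ x ‖² = sum (λ i → x i * x i)

  abstract

    ‖‖²-cong : ∀ {x y} → x ≈ᵥ y → ‖ x ‖² ≈ ‖ y ‖²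
    ‖‖²-cong x≈y = sum-cong-≋ (λ i → *-cong (x≈y i) (x≈y i))

    ‖‖²-nonNeg : ∀ x → 0# ≤ ‖ x ‖²
    ‖‖²-nonNeg x = sum-nonNeg (λ i → x*x-nonNeg (x i))

    coordinate≤‖‖² : ∀ x i → x i * x i ≤ ‖ x ‖²
    coordinate≤‖‖² x = term≤sum (λ i → x*x-nonNeg (x i))

    ‖‖²≤0⇒≈0 : ∀ {x} → ‖ x ‖² ≤ 0# → x ≈ᵥ 0ᵥ
    ‖‖²≤0⇒≈0 {x} x≤0 i =
      x*x≈0⇒x≈0 (antisym (≤-trans (coordinate≤‖‖² x i) x≤0) (x*x-nonNeg (x i)))

    ≈0⇒‖‖²≈0 : ∀ {x} → x ≈ᵥ 0ᵥ → ‖ x ‖² ≈ 0#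
    ≈0⇒‖‖²≈0 x≈0 =
      trans (sum-cong-≋ (λ i → trans (*-congˡ (x≈0 i)) (zeroʳ _))) (sum-replicate-zero d)

    ‖‖²-· : ∀ t x → ‖ t · x ‖² ≈ t * t * ‖ x ‖²
    ‖‖²-· t x = begin-equality
      sum (λ i → t * x i * (t * x i))    ≈⟨ sum-cong-≋ (λ i → solve 2 (λ t x → t :* x :* (t :* x) := t :* t :* (x :* x)) refl t (x i)) ⟩
      sum (λ i → t * t * (x i * x i))    ≈⟨ sym (*-distribˡ-sum (t * t) (λ i → x i * x i)) ⟩
      t * t * ‖ x ‖²                     ∎

    -- Here `z` is the midpoint, described by `2z = x + y` so that the identity contains no
    -- division.
    parallelogram : ∀ {x y z} → z +ᵥ z ≈ᵥ x +ᵥ y →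
                    ‖ x -ᵥ y ‖² + 2# * 2# * ‖ z ‖² ≈ 2# * ‖ x ‖² + 2# * ‖ y ‖²
    parallelogram {x} {y} {z} 2z≈x+y = begin-equality
      ‖ x -ᵥ y ‖² + 2# * 2# * ‖ z ‖²                                        ≈⟨ +-congʳ (sym (*-identityˡ _)) ⟩
      1# * ‖ x -ᵥ y ‖² + 2# * 2# * ‖ z ‖²                                   ≈⟨ sym (sum-linear 1# (2# * 2#) (λ i → (x i - y i) * (x i - y i)) (λ i → z i * z i)) ⟩
      sum (λ i → 1# * ((x i - y i) * (x i - y i)) + 2# * 2# * (z i * z i))  ≈⟨ sum-cong-≋ coordinate ⟩
      sum (λ i → 2# * (x i * x i) + 2# * (y i * y i))                       ≈⟨ sum-linear 2# 2# (λ i → x i * x i) (λ i → y i * y i) ⟩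
      2# * ‖ x ‖² + 2# * ‖ y ‖²                                             ∎
      where
      coordinate : ∀ i → 1# * ((x i - y i) * (x i - y i)) + 2# * 2# * (z i * z i) ≈
                         2# * (x i * x i) + 2# * (y i * y i)
      coordinate i = begin-equality
        1# * ((x i - y i) * (x i - y i)) + 2# * 2# * (z i * z i)         ≈⟨ solve 3 (λ x y z → :1 :* ((x :- y) :* (x :- y)) :+ :2 :* :2 :* (z :* z) := (x :- y) :* (x :- y) :+ (z :+ z) :* (z :+ z)) refl (x i) (y i) (z i) ⟩
        (x i - y i) * (x i - y i) + (z i + z i) * (z i + z i)            ≈⟨ +-congˡ (*-cong (2z≈x+y i) (2z≈x+y i)) ⟩
        (x i - y i) * (x i - y i) + (x i + y i) * (x i + y i)            ≈⟨ solve 2 (λ x y → (x :- y) :* (x :- y) :+ (x :+ y) :* (x :+ y) := :2 :* (x :* x) :+ :2 :* (y :* y)) refl (x i) (y i) ⟩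
        2# * (x i * x i) + 2# * (y i * y i)                              ∎

    -- With b = y - x, the two sides differ by ‖ t · x - b ‖².
    t‖y‖²≤ : ∀ t x y → t * ‖ y ‖² ≤ t * (1# + t) * ‖ x ‖² + (1# + t) * ‖ y -ᵥ x ‖²
    t‖y‖²≤ t x y = begin
      t * ‖ y ‖²                                                                          ≈⟨ *-distribˡ-sum t (λ i → y i * y i) ⟩
      sum (λ i → t * (y i * y i))                                                         ≤⟨ sum-mono-≤ (λ i → coordinate (x i) (y i)) ⟩
      sum (λ i → t * (1# + t) * (x i * x i) + (1# + t) * ((y i - x i) * (y i - x i)))     ≈⟨ sum-linear (t * (1# + t)) (1# + t) (λ i → x i * x i) (λ i → (y i - x i) * (y i - x i)) ⟩
      t * (1# + t) * ‖ x ‖² + (1# + t) * ‖ y -ᵥ x ‖²                                      ∎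
      where
      coordinate : ∀ x y → t * (y * y) ≤ t * (1# + t) * (x * x) + (1# + t) * ((y - x) * (y - x))
      coordinate x y = begin
        t * (y * y)                                                      ≤⟨ x≤x+y _ (x*x-nonNeg (t * x - (y - x))) ⟩
        t * (y * y) + (t * x - (y - x)) * (t * x - (y - x))              ≈⟨ solve 3 (λ t x y → t :* (y :* y) :+ (t :* x :- (y :- x)) :* (t :* x :- (y :- x)) := t :* (:1 :+ t) :* (x :* x) :+ (:1 :+ t) :* ((y :- x) :* (y :- x))) refl t x y ⟩
        t * (1# + t) * (x * x) + (1# + t) * ((y - x) * (y - x))          ∎

    norm : ∀ x → ∃ λ n → IsNorm x n
    norm x = sqrt (‖‖²-nonNeg x)

    norm-mono-≤ : ∀ {x y m n} → IsNorm x m → IsNorm y n → ‖ x ‖² ≤ ‖ y ‖² → m ≤ n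
    norm-mono-≤ {x} {y} {m} {n} (_ , mm≈) (0≤n , nn≈) x≤y = *-self-cancel-≤ 0≤n (begin
      m * m   ≈⟨ mm≈ ⟩
      ‖ x ‖²  ≤⟨ x≤y ⟩
      ‖ y ‖²  ≈⟨ sym nn≈ ⟩
      n * n   ∎)

    norm-cancel-≤ : ∀ {x y m n} → IsNorm x m → IsNorm y n → m ≤ n → ‖ x ‖² ≤ ‖ y ‖²
    norm-cancel-≤ {x} {y} {m} {n} (0≤m , mm≈) (_ , nn≈) m≤n = begin
      ‖ x ‖²  ≈⟨ sym mm≈ ⟩
      m * m   ≤⟨ *-mono-≤ 0≤m m≤n 0≤m m≤n ⟩
      n * n   ≈⟨ nn≈ ⟩
      ‖ y ‖²  ∎

  -- The closure again, measured by squared distance; replacing `ε` by its square or its square root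
  -- translates to and from `InClosure`.
  Approximable : Pred Point 0ℓ → Pred Point 0ℓ
  Approximable K x = ∀ {ε} → 0# < ε → ∃ λ y → y ∈ K × ‖ x -ᵥ y ‖² < ε

  abstract

    approximable⇒inClosure : ∀ {K x} → Approximable K x → InClosure K x
    approximable⇒inClosure {K} {x} approximable {ε} 0<ε =
      let y , y∈K , ‖x-y‖²<ε² = approximable (*-pos 0<ε 0<ε)
          n , 0≤n , nn≈        = norm (x -ᵥ y)
      in y , y∈K , n , (0≤n , nn≈) , *-self-cancel-< (<⇒≤ 0<ε) (begin-strict
        n * n         ≈⟨ nn≈ ⟩
        ‖ x -ᵥ y ‖²   <⟨ ‖x-y‖²<ε² ⟩
        ε * ε         ∎)

    inClosure⇒approximable : ∀ {K x} → InClosure K x → Approximable K x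
    inClosure⇒approximable {K} {x} inClosure {ε} 0<ε =
      let s , 0≤s , ss≈ε = sqrt (<⇒≤ 0<ε)
          0<s = ≰⇒> (λ s≤0 → proj₂ 0<ε (begin-equality
                  0#        ≈⟨ sym (zeroˡ s) ⟩
                  0# * s    ≈⟨ *-congʳ (antisym 0≤s s≤0) ⟩
                  s * s     ≈⟨ ss≈ε ⟩
                  ε         ∎))
          y , y∈K , n , (0≤n , nn≈) , n<s = inClosure 0<s
      in y , y∈K , (begin-strict
        ‖ x -ᵥ y ‖²   ≈⟨ sym nn≈ ⟩
        n * n         <⟨ *-self-mono-< 0≤n n<s ⟩
        s * s         ≈⟨ ss≈ε ⟩
        ε             ∎)

    approximable⇒∈ : ∀ {K x} → Closed K → Approximable K x → x ∈ K
    approximable⇒∈ {K} closed approximable = closed (approximable⇒inClosure {K} approximable)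

    -- `x` lies at distance zero from `y`, hence within every `ε` of it.
    closed-respects : ∀ {K x y} → Closed K → x ≈ᵥ y → x ∈ K → y ∈ K
    closed-respects {K} {x} {y} closed x≈y x∈K = approximable⇒∈ {K} closed λ {ε} 0<ε →
      x , x∈K , (begin-strict
        ‖ y -ᵥ x ‖²  ≈⟨ ≈0⇒‖‖²≈0 (λ i → trans (+-congʳ (sym (x≈y i))) (-‿inverseʳ (x i))) ⟩
        0#           <⟨ 0<ε ⟩
        ε            ∎)

    -- Dividing t‖y‖²≤ by t, for x within t of y.
    ball-closed : ∀ {c y} → Approximable (λ x → ‖ x ‖² ≤ c) y → ‖ y ‖² ≤ c
    ball-closed {c} {y} approximable = x≤y+ε⇒x≤y λ {ε} 0<ε →
      let t , 0<t , t≤1 , tc′<ε = small-multiple 0<ε (+-nonNeg 0≤c (<⇒≤ 0<2))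
          x , ‖x‖²≤c , ‖y-x‖²<tt = approximable (*-pos 0<t 0<t)
          0≤1+t = +-nonNeg 0≤1 (<⇒≤ 0<t)
      in begin-strict
        ‖ y ‖²                      ≤⟨ *-cancelˡ-≤ 0<t (begin
          t * ‖ y ‖²                                        ≤⟨ t‖y‖²≤ t x y ⟩
          t * (1# + t) * ‖ x ‖² + (1# + t) * ‖ y -ᵥ x ‖²    ≤⟨ +-mono-≤ (*-monoˡ-≤ (*-nonNeg (<⇒≤ 0<t) 0≤1+t) ‖x‖²≤c)
                                                                        (*-monoˡ-≤ 0≤1+t (<⇒≤ ‖y-x‖²<tt)) ⟩
          t * (1# + t) * c + (1# + t) * (t * t)             ≈⟨ solve 2 (λ t c → t :* (:1 :+ t) :* c :+ (:1 :+ t) :* (t :* t) := t :* (c :+ t :* (c :+ (:1 :+ t)))) refl t c ⟩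
          t * (c + t * (c + (1# + t)))                      ∎) ⟩
        c + t * (c + (1# + t))      ≤⟨ +-monoʳ-≤ c (*-monoˡ-≤ (<⇒≤ 0<t) (+-monoʳ-≤ c (+-monoʳ-≤ 1# t≤1))) ⟩
        c + t * (c + 2#)            <⟨ +-monoʳ-< c tc′<ε ⟩
        c + ε                       ∎
      where
      0≤c : 0# ≤ c
      0≤c = let x , ‖x‖²≤c , _ = approximable 0<1 in ≤-trans (‖‖²-nonNeg x) ‖x‖²≤c

  Minimises : Pred Point 0ℓ → Pred Point 0ℓ
  Minimises K q = q ∈ K × ∀ {x} → x ∈ K → ‖ q ‖² ≤ ‖ x ‖²

  abstract

    midpoint : ∀ {K x y} → Convex K → x ∈ K → y ∈ K → ∃ λ z → z ∈ K × z +ᵥ z ≈ᵥ x +ᵥ y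
    midpoint {K} {x} {y} convex x∈K y∈K = (1# - h) · x +ᵥ h · y , convex x∈K y∈K 0≤h h≤1 , doubled
      where
      1/2 : ∃ λ h → 2# * h ≈ 1#
      1/2 = inverse 2# (proj₂ 0<2 ∘ sym)
      h : Carrier
      h = proj₁ 1/2
      2h≈1 : 2# * h ≈ 1#
      2h≈1 = proj₂ 1/2
      0≤h : 0# ≤ h
      0≤h = *-cancelˡ-≤ 0<2 (begin
        2# * 0#  ≈⟨ zeroʳ 2# ⟩
        0#       ≤⟨ 0≤1 ⟩
        1#       ≈⟨ sym 2h≈1 ⟩
        2# * h   ∎)
      h≤1 : h ≤ 1#
      h≤1 = *-cancelˡ-≤ 0<2 (begin
        2# * h   ≈⟨ 2h≈1 ⟩
        1#       ≤⟨ x≤x+y 1# 0≤1 ⟩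
        2#       ≈⟨ sym (*-identityʳ 2#) ⟩
        2# * 1#  ∎)
      -- `h` is known only through `2# * h ≈ 1#`, which the solver cannot use; the identity isolates
      -- the remainder that this equation kills.
      identity : ∀ h x y → ((1# - h) * x + h * y) + ((1# - h) * x + h * y) ≈ x + y + (2# * h - 1#) * (y - x)
      identity = solve 3 (λ h x y → ((:1 :- h) :* x :+ h :* y) :+ ((:1 :- h) :* x :+ h :* y) :=
                                    x :+ y :+ (:2 :* h :- :1) :* (y :- x)) refl
      doubled : ((1# - h) · x +ᵥ h · y) +ᵥ ((1# - h) · x +ᵥ h · y) ≈ᵥ x +ᵥ y
      doubled i = begin-equality
        ((1# - h) * x i + h * y i) + ((1# - h) * x i + h * y i)  ≈⟨ identity h (x i) (y i) ⟩
        x i + y i + (2# * h - 1#) * (y i - x i)                  ≈⟨ +-congˡ (*-congʳ (trans (+-congʳ 2h≈1) (-‿inverseʳ 1#))) ⟩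
        x i + y i + 0# * (y i - x i)                             ≈⟨ +-congˡ (zeroˡ _) ⟩
        x i + y i + 0#                                           ≈⟨ +-identityʳ _ ⟩
        x i + y i                                                ∎

    -- The midpoint `z` lies in `K`, so `4‖z‖² ≥ 4m`, and the parallelogram law leaves at most
    -- `4(m + e) - 4m` for `‖ x -ᵥ y ‖²`. The case `e = 0` yields uniqueness of the minimiser, and
    -- `e = η²` the shrinking of the near-minimal sets.
    near-minimal⇒near : ∀ {K m e x y} → Convex K → (∀ {x} → x ∈ K → m ≤ ‖ x ‖²) →
                        x ∈ K → y ∈ K → ‖ x ‖² ≤ m + e → ‖ y ‖² ≤ m + e → ‖ x -ᵥ y ‖² ≤ 2# * 2# * e
    near-minimal⇒near {K} {m} {e} {x} {y} convex lower x∈K y∈K x≤ y≤ =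
      let z , z∈K , 2z≈x+y = midpoint {K} convex x∈K y∈K in
      begin
        ‖ x -ᵥ y ‖²                                    ≤⟨ x+z≤y⇒x≤y-z (begin
          ‖ x -ᵥ y ‖² + 2# * 2# * m                      ≤⟨ +-monoʳ-≤ _ (*-monoˡ-≤ (*-nonNeg (<⇒≤ 0<2) (<⇒≤ 0<2)) (lower z∈K)) ⟩
          ‖ x -ᵥ y ‖² + 2# * 2# * ‖ z ‖²                 ≈⟨ parallelogram {x} {y} {z} 2z≈x+y ⟩
          2# * ‖ x ‖² + 2# * ‖ y ‖²                      ≤⟨ +-mono-≤ (*-monoˡ-≤ (<⇒≤ 0<2) x≤) (*-monoˡ-≤ (<⇒≤ 0<2) y≤) ⟩
          2# * (m + e) + 2# * (m + e)                    ∎) ⟩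
        2# * (m + e) + 2# * (m + e) - 2# * 2# * m      ≈⟨ solve 2 (λ m e → :2 :* (m :+ e) :+ :2 :* (m :+ e) :- :2 :* :2 :* m := :2 :* :2 :* e) refl m e ⟩
        2# * 2# * e                                    ∎

    minimiser-unique : ∀ {K x y} → Convex K → Minimises K x → y ∈ K → ‖ y ‖² ≤ ‖ x ‖² → x ≈ᵥ y
    minimiser-unique {K} {x} {y} convex (x∈K , minimal) y∈K y≤x i = begin-equality
      x i                ≈⟨ solve 2 (λ x y → x := (x :- y) :+ y) refl (x i) (y i) ⟩
      (x i - y i) + y i  ≈⟨ +-congʳ (‖‖²≤0⇒≈0 {x -ᵥ y} ‖x-y‖²≤0 i) ⟩
      0# + y i           ≈⟨ +-identityˡ (y i) ⟩
      y i                ∎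
      where
      ‖x‖²≤‖x‖²+0 : ‖ x ‖² ≤ ‖ x ‖² + 0#
      ‖x‖²≤‖x‖²+0 = ≤-reflexive (sym (+-identityʳ _))
      ‖x-y‖²≤0 : ‖ x -ᵥ y ‖² ≤ 0#
      ‖x-y‖²≤0 = begin
        ‖ x -ᵥ y ‖²   ≤⟨ near-minimal⇒near {K} convex minimal x∈K y∈K ‖x‖²≤‖x‖²+0 (≤-trans y≤x ‖x‖²≤‖x‖²+0) ⟩
        2# * 2# * 0#  ≈⟨ zeroʳ _ ⟩
        0#            ∎

  -- The points of K whose squared norm is within η² of the infimum m have
  -- diameter at most 2η; q is the coordinatewise lower limit of these points as η → 0.
  module NearMinimal {K : Pred Point 0ℓ} (convex : Convex K) {m : Carrier}
    (inf : IsInfimum (λ n → ∃ λ x → x ∈ K × n ≈ ‖ x ‖²) m) where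

    S : Carrier → Pred Point 0ℓ
    S η x = x ∈ K × ‖ x ‖² ≤ m + η * η

    -- Eventual lower bounds of the coordinate `i`. Completeness applies to this set directly,
    -- without choosing a point in each `S η`.
    A : Fin d → Pred Carrier 0ℓ
    A i a = ∃ λ η → 0# < η × ∀ {x} → x ∈ S η → a ≤ x i

    abstract

      S-nonempty : ∀ {η} → 0# < η → ∃ λ x → x ∈ S η
      S-nonempty {η} 0<η = decidable-stable em λ ∄x → <⇒≱ (x<x+y m (*-pos 0<η 0<η))
        (proj₂ inf λ {n} (x , x∈K , n≈) → begin
          m + η * η  ≤⟨ ≮⇒≥ (λ x< → ∄x (x , x∈K , <⇒≤ x<)) ⟩
          ‖ x ‖²     ≈⟨ sym n≈ ⟩
          n          ∎)

      S-mono : ∀ {η η′ x} → 0# ≤ η → η ≤ η′ → x ∈ S η → x ∈ S η′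
      S-mono 0≤η η≤η′ (x∈K , x≤) = x∈K , ≤-trans x≤ (+-monoʳ-≤ m (*-mono-≤ 0≤η η≤η′ 0≤η η≤η′))

      S-coordinates : ∀ {η x y} → 0# ≤ η → x ∈ S η → y ∈ S η → ∀ i → x i ≤ y i + 2# * η
      S-coordinates {η} {x} {y} 0≤η (x∈K , x≤) (y∈K , y≤) i = begin
        x i                ≈⟨ solve 2 (λ x y → x := y :+ (x :- y)) refl (x i) (y i) ⟩
        y i + (x i - y i)  ≤⟨ +-monoʳ-≤ (y i) (*-self-cancel-≤ (*-nonNeg (<⇒≤ 0<2) 0≤η) (begin
          (x i - y i) * (x i - y i)  ≤⟨ coordinate≤‖‖² (x -ᵥ y) i ⟩
          ‖ x -ᵥ y ‖²                ≤⟨ near-minimal⇒near {K} convex (λ x∈K → proj₁ inf (_ , x∈K , refl)) x∈K y∈K x≤ y≤ ⟩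
          2# * 2# * (η * η)          ≈⟨ solve 2 (λ a η → a :* a :* (η :* η) := a :* η :* (a :* η)) refl 2# η ⟩
          2# * η * (2# * η)          ∎)) ⟩
        y i + 2# * η       ∎

      min-positive : ∀ {x y} → 0# < x → 0# < y → ∃ λ z → 0# < z × z ≤ x × z ≤ y
      min-positive {x} {y} 0<x 0<y with total x y
      ... | inj₁ x≤y = x , 0<x , ≤-refl , x≤y
      ... | inj₂ y≤x = y , 0<y , y≤x , ≤-refl

      A-upper : ∀ {η x} → 0# < η → x ∈ S η → ∀ i → UpperBound (A i) (x i + 2# * η)
      A-upper {η} {x} 0<η x∈S i {a} (η′ , 0<η′ , a≤) =
        -- The bound `a` concerns `S η′`, while `x` lies in `S η`; a point of `S ζ` belongs to both
        -- and links them.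
        let ζ , 0<ζ , ζ≤η , ζ≤η′ = min-positive 0<η 0<η′
            y , y∈S = S-nonempty 0<ζ
        in begin
          a             ≤⟨ a≤ (S-mono (<⇒≤ 0<ζ) ζ≤η′ y∈S) ⟩
          y i           ≤⟨ S-coordinates (<⇒≤ 0<η) (S-mono (<⇒≤ 0<ζ) ζ≤η y∈S) x∈S i ⟩
          x i + 2# * η  ∎

      A-member : ∀ {η x} → 0# < η → x ∈ S η → ∀ i → (x i - 2# * η) ∈ A i
      A-member {η} {x} 0<η x∈S i = η , 0<η , λ {y} y∈S → begin
        x i - 2# * η            ≤⟨ +-monoˡ-≤ (- (2# * η)) (S-coordinates (<⇒≤ 0<η) x∈S y∈S i) ⟩
        y i + 2# * η - 2# * η   ≈⟨ solve 2 (λ y c → y :+ c :- c := y) refl (y i) (2# * η) ⟩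
        y i                     ∎

      limit : ∀ i → ∃ λ s → IsSupremum (A i) s
      limit i = let x , x∈S = S-nonempty 0<1 in
        complete (A i) (_ , A-member 0<1 x∈S i) (_ , A-upper 0<1 x∈S i)

    q : Point
    q i = proj₁ (limit i)

    abstract

      -- With `c = 2η`, each `q i` lies between `x i - c` and `x i + c`. The product of the two
      -- nonnegative gaps is `c² - (q i - x i)²`, which bounds the square without absolute values.
      -- The sum of ones is `d` as a real number.
      ‖q-x‖²≤ : ∀ {η x} → 0# < η → x ∈ S η → ‖ q -ᵥ x ‖² ≤ η * η * (2# * 2# * sum {d} (λ _ → 1#))
      ‖q-x‖²≤ {η} {x} 0<η x∈S = begin
        ‖ q -ᵥ x ‖²                               ≤⟨ sum-mono-≤ coordinate ⟩
        sum {d} (λ _ → c * c * 1#)                ≈⟨ sym (*-distribˡ-sum {d} (c * c) (λ _ → 1#)) ⟩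
        c * c * sum {d} (λ _ → 1#)                ≈⟨ solve 3 (λ a η n → a :* η :* (a :* η) :* n := η :* η :* (a :* a :* n)) refl 2# η (sum {d} (λ _ → 1#)) ⟩
        η * η * (2# * 2# * sum {d} (λ _ → 1#))    ∎
        where
        c : Carrier
        c = 2# * η
        coordinate : ∀ i → (q i - x i) * (q i - x i) ≤ c * c * 1#
        coordinate i = 0≤y-x⇒x≤y (begin
          0#                                               ≤⟨ *-nonNeg (x≤y⇒0≤y-x (proj₂ (proj₂ (limit i)) (A-upper 0<η x∈S i)))
                                                                       (x≤y⇒0≤y-x (proj₁ (proj₂ (limit i)) (A-member 0<η x∈S i))) ⟩
          (x i + c - q i) * (q i - (x i - c))              ≈⟨ solve 3 (λ x c q → (x :+ c :- q) :* (q :- (x :- c)) := c :* c :* :1 :- (q :- x) :* (q :- x)) refl (x i) c (q i) ⟩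
          c * c * 1# - (q i - x i) * (q i - x i)           ∎)

      -- The approximants are kept inside `S η`, not merely in `K`, so that the bound `m + η * η` on
      -- squared norms passes to `q`.
      q-approximable : ∀ {η} → 0# < η → Approximable (S η) q
      q-approximable {η} 0<η {ε} 0<ε =
        let t , 0<t , t≤1 , tc<ε = small-multiple 0<ε 0≤c
            ζ , 0<ζ , ζ≤t , ζ≤η  = min-positive 0<t 0<η
            x , x∈S              = S-nonempty 0<ζ
        in x , S-mono (<⇒≤ 0<ζ) ζ≤η x∈S , (begin-strict
          ‖ q -ᵥ x ‖²     ≤⟨ ‖q-x‖²≤ 0<ζ x∈S ⟩
          ζ * ζ * c       ≈⟨ *-comm _ c ⟩
          -- One factor `ζ` is bounded by `t` and the other by `1#`, which brings the quadratic
          -- bound to the linear form of `small-multiple`.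
          c * (ζ * ζ)     ≤⟨ *-monoˡ-≤ 0≤c (*-mono-≤ (<⇒≤ 0<ζ) ζ≤t (<⇒≤ 0<ζ) (≤-trans ζ≤t t≤1)) ⟩
          c * (t * 1#)    ≈⟨ solve 2 (λ c t → c :* (t :* :1) := t :* c) refl c t ⟩
          t * c           <⟨ tc<ε ⟩
          ε               ∎)
        where
        c : Carrier
        c = 2# * 2# * sum {d} (λ _ → 1#)
        0≤c : 0# ≤ c
        0≤c = *-nonNeg (*-nonNeg (<⇒≤ 0<2) (<⇒≤ 0<2)) (sum-nonNeg {d} (λ _ → 0≤1))

      ‖q‖²≤m : ‖ q ‖² ≤ m
      ‖q‖²≤m = x≤y+ε⇒x≤y λ {ε} 0<ε →
        let t , 0<t , t≤1 , t1<ε = small-multiple 0<ε 0≤1 in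
        begin-strict
          ‖ q ‖²       ≤⟨ ball-closed {y = q} (λ 0<ε → let x , (_ , x≤) , near = q-approximable 0<t 0<ε in x , x≤ , near) ⟩
          m + t * t    ≤⟨ +-monoʳ-≤ m (*-monoˡ-≤ (<⇒≤ 0<t) t≤1) ⟩
          m + t * 1#   <⟨ +-monoʳ-< m t1<ε ⟩
          m + ε        ∎

      q-minimises : Closed K → Minimises K q
      q-minimises closed =
        approximable⇒∈ {K} closed (λ 0<ε → let x , (x∈K , _) , near = q-approximable 0<1 0<ε in x , x∈K , near) ,
        λ x∈K → ≤-trans ‖q‖²≤m (proj₁ inf (_ , x∈K , refl))

  abstract

    minimiser : ∀ {K} → Satisfiable K → Closed K → Convex K → ∃ λ q → Minimises K q
    minimiser {K} (x , x∈K) closed convex =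
      let m , inf = infimum (λ n → ∃ λ x → x ∈ K × n ≈ ‖ x ‖²) (‖ x ‖² , x , x∈K , refl)
                      (0# , λ (y , _ , n≈) → ≤-trans (‖‖²-nonNeg y) (≤-reflexive (sym n≈)))
      in NearMinimal.q {K} convex inf , NearMinimal.q-minimises {K} convex inf closed

    -- `_≤ᵣ_` asserts that both distances exist, so every competing flat must be given one, attained
    -- or not.
    norm-infimum : ∀ {K} → Satisfiable K →
                   ∃ λ δ → IsInfimum (λ n → ∃ λ x → x ∈ K × IsNorm x n) δ
    norm-infimum {K} (x , x∈K) = let n , isNorm = norm x in
      infimum _ (n , x , x∈K , isNorm) (0# , λ (_ , _ , 0≤n , _) → 0≤n)

-- The lineality space

module Lineality (em : ExcludedMiddle 0ℓ) (ℝ : RealField) (d : ℕ) where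

  open RealField ℝ hiding (zero)
  open RealProperties em ℝ
  open Euclidean ℝ d
  open ClosestPoint em ℝ d
  open LinearAlgebra em ℝ d
  open PartialOrderReasoning poset
  open LinearSubspace using (Member)
  open AffineFlat using (base; direction)

  flat-convex : ∀ L → Convex (Points L)
  flat-convex L {x} {y} x∈L y∈L {t} _ _ =
    respects (λ i → solve 4 (λ t x y b → (:1 :- t) :* (x :- b) :+ t :* (y :- b) := (:1 :- t) :* x :+ t :* y :- b) refl t (x i) (y i) (base L i))
      (+-closed (·-closed (1# - t) x∈L) (·-closed t y∈L))
    where open LinearSubspace (direction L)

  base∈ : ∀ L → base L ∈ Points L
  base∈ L = LinearSubspace.respects (direction L) (λ i → sym (-‿inverseʳ (base L i)))
    (LinearSubspace.0-closed (direction L))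

  base+direction∈ : ∀ L {u} → u ∈ Member (direction L) → (base L +ᵥ u) ∈ Points L
  base+direction∈ L {u} = LinearSubspace.respects (direction L)
    (λ i → solve 2 (λ b u → u := b :+ u :- b) refl (base L i) (u i))

  module _ {K : Pred Point 0ℓ} (closed : Closed K) where

    -- Asking for the whole line through every point of `K` makes closure under addition a
    -- composition of two translations. Closedness supplies the transport along `_≈ᵥ_`.
    lineality : LinearSubspace
    lineality = record
      { Member   = λ u → ∀ {x} → x ∈ K → ∀ t → (x +ᵥ t · u) ∈ K
      ; respects = λ u≈v u∈W x∈K t → closed-respects {K} closed (λ i → +-congˡ (*-congˡ (u≈v i))) (u∈W x∈K t)
      ; 0-closed = λ x∈K t → closed-respects {K} closed
          (λ i → sym (trans (+-congˡ (zeroʳ t)) (+-identityʳ _))) x∈K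
      ; +-closed = λ {u} {v} u∈W v∈W {x} x∈K t → closed-respects {K} closed
          (λ i → solve 4 (λ x t u v → x :+ t :* u :+ t :* v := x :+ t :* (u :+ v)) refl (x i) t (u i) (v i))
          (v∈W (u∈W x∈K t) t)
      ; ·-closed = λ s {u} u∈W {x} x∈K t → closed-respects {K} closed
          (λ i → +-congˡ (*-assoc t s (u i))) (u∈W x∈K (t * s))
      }

    -- The points (1 - s) x + s (b + (t/s) u) of K, with b the base of L, tend to x + t u as s → 0.
    direction⊆lineality : Convex K → ∀ L → Points L ⊆ K → Member (direction L) ⊆ Member lineality
    direction⊆lineality convex L L⊆K {u} u∈L {x} x∈K t = approximable⇒∈ {K} closed λ {ε} 0<ε →
      let s , 0<s , s≤1 , sc<ε = small-multiple 0<ε (‖‖²-nonNeg (x -ᵥ b))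
          s⁻¹ , ss⁻¹≈1         = inverse s (proj₂ 0<s ∘ sym)
          z = b +ᵥ (s⁻¹ * t) · u
          y = (1# - s) · x +ᵥ s · z
      in y , convex x∈K (L⊆K (base+direction∈ L (·-closed (s⁻¹ * t) u∈L))) (<⇒≤ 0<s) s≤1 , (begin-strict
        ‖ (x +ᵥ t · u) -ᵥ y ‖²     ≈⟨ ‖‖²-cong (λ i → difference ss⁻¹≈1 (x i) (u i) (b i)) ⟩
        ‖ s · (x -ᵥ b) ‖²          ≈⟨ ‖‖²-· s (x -ᵥ b) ⟩
        s * s * ‖ x -ᵥ b ‖²        ≤⟨ *-mono-≤ (*-nonNeg (<⇒≤ 0<s) (<⇒≤ 0<s)) (*-monoˡ-≤ (<⇒≤ 0<s) s≤1) (‖‖²-nonNeg (x -ᵥ b)) ≤-refl ⟩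
        s * 1# * ‖ x -ᵥ b ‖²       ≈⟨ *-congʳ (*-identityʳ s) ⟩
        s * ‖ x -ᵥ b ‖²            <⟨ sc<ε ⟩
        ε                          ∎)
      where
      b : Point
      b = base L
      open LinearSubspace (direction L) using (·-closed)
      difference : ∀ {s s⁻¹} → s * s⁻¹ ≈ 1# → ∀ x u b →
                   x + t * u - ((1# - s) * x + s * (b + s⁻¹ * t * u)) ≈ s * (x - b)
      difference {s} {s⁻¹} ss⁻¹≈1 x u b = begin-equality
        x + t * u - ((1# - s) * x + s * (b + s⁻¹ * t * u))  ≈⟨ solve 6 (λ x t u s r b → x :+ t :* u :- ((:1 :- s) :* x :+ s :* (b :+ r :* t :* u)) := s :* (x :- b) :+ t :* u :* (:1 :- s :* r)) refl x t u s s⁻¹ b ⟩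
        s * (x - b) + t * u * (1# - s * s⁻¹)                ≈⟨ +-congˡ (*-congˡ (trans (+-congˡ (-‿cong ss⁻¹≈1)) (-‿inverseʳ 1#))) ⟩
        s * (x - b) + t * u * 0#                            ≈⟨ +-congˡ (zeroʳ _) ⟩
        s * (x - b) + 0#                                    ≈⟨ +-identityʳ _ ⟩
        s * (x - b)                                         ∎

    -- Membership of `x -ᵥ base L` in the lineality space says that `p +ᵥ t · (x -ᵥ base L)` lies in
    -- `K` for all `p` in `K` and all `t`. For fixed `p` and `t` this survives a limit in `x`,
    -- because `K` is closed.
    flat-closed : ∀ L → Member (direction L) ≐ Member lineality → Closed (Points L)
    flat-closed L (⊆W , W⊆) {x} x∈closure = W⊆ λ {p} p∈K t → approximable⇒∈ {K} closed λ {ε} 0<ε →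
      let s , 0<s , _ , stt<ε   = small-multiple 0<ε (x*x-nonNeg t)
          y , y∈L , ‖x-y‖²<s    = inClosure⇒approximable {Points L} x∈closure 0<s
      in p +ᵥ t · (y -ᵥ base L) , ⊆W y∈L p∈K t , (begin-strict
        ‖ (p +ᵥ t · (x -ᵥ base L)) -ᵥ (p +ᵥ t · (y -ᵥ base L)) ‖²  ≈⟨ ‖‖²-cong (λ i → solve 5 (λ p t x y b → p :+ t :* (x :- b) :- (p :+ t :* (y :- b)) := t :* (x :- y)) refl (p i) t (x i) (y i) (base L i)) ⟩
        ‖ t · (x -ᵥ y) ‖²                                          ≈⟨ ‖‖²-· t (x -ᵥ y) ⟩
        t * t * ‖ x -ᵥ y ‖²                                        ≤⟨ *-monoˡ-≤ (x*x-nonNeg t) (<⇒≤ ‖x-y‖²<s) ⟩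
        t * t * s                                                  ≈⟨ *-comm _ s ⟩
        s * (t * t)                                                <⟨ stt<ε ⟩
        ε                                                          ∎)

    linealityFlat : Point → AffineFlat
    linealityFlat q = record { base = q ; direction = lineality }

    linealityFlat⊆ : ∀ {q} → q ∈ K → Points (linealityFlat q) ⊆ K
    linealityFlat⊆ {q} q∈K {x} x-q∈W = closed-respects {K} closed
      (λ i → solve 2 (λ q x → q :+ :1 :* (x :- q) := x) refl (q i) (x i)) (x-q∈W q∈K 1#)

    module _ (convex : Convex K) {q : Point} (minimises : Minimises K q) where

      linealityFlat-isM : IsM K (linealityFlat q)
      linealityFlat-isM = linealityFlat⊆ (proj₁ minimises) , λ L L⊆K →
        let k  , v  , v-basis  = basis lineality
            k′ , v′ , v′-basis = basis (direction L)
            k′≤k  = dim-mono {lineality} {direction L} (direction⊆lineality convex L L⊆K) v-basis v′-basis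
            n , isNorm = norm q
            -- Stated for any subset of `K` to serve twice: it shows that `n` is the distance of the
            -- flat through `q`, and that it is at most the distance of `L`.
            n≤ : ∀ {P : Pred Point 0ℓ} → P ⊆ K → LowerBound (λ m → ∃ λ x → x ∈ P × IsNorm x m) n
            n≤ P⊆K = λ (x , x∈P , isNorm′) → norm-mono-≤ isNorm isNorm′ (proj₂ minimises (P⊆K x∈P))
            δ , isInfimum = norm-infimum (base L , base∈ L)
        in (d ℕ.∸ k , n) , (d ℕ.∸ k′ , δ) ,
           ((k , (v , v-basis) , ≡.refl) ,
             n≤ (linealityFlat⊆ (proj₁ minimises)) , λ b≤ → b≤ (q , base∈ (linealityFlat q) , isNorm)) ,
           ((k′ , (v′ , v′-basis) , ≡.refl) , isInfimum) ,
           lex (independent⇒≤dim (proj₁ (proj₂ v-basis))) (ℕ.m≤n⇒m<n∨m≡n k′≤k) (proj₂ isInfimum (n≤ L⊆K))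
        where
        -- `k ≤ d` keeps truncated subtraction strict when the dimensions differ.
        lex : ∀ {k k′ n δ} → k ℕ.≤ d → k′ ℕ.< k ⊎ k′ ≡ k → n ≤ δ → (d ℕ.∸ k , n) ≤ₗₑₓ (d ℕ.∸ k′ , δ)
        lex k≤d (inj₁ k′<k)   n≤δ = inj₁ (ℕ.∸-monoʳ-< k′<k k≤d)
        lex k≤d (inj₂ ≡.refl) n≤δ = inj₂ (≡.refl , n≤δ)

      -- The direction of `L` lies in the lineality space, so `k ≤ k′` and `L` cannot win on
      -- codimension. The codimensions therefore agree, and as both dimensions are at most `d`, the
      -- truncated subtraction cancels to `k ≡ k′`. The decision falls to the distances, returned as
      -- witnesses because `Is-r` gives only the graph of r.
      compare : ∀ {L} → Points L ⊆ K → L ≤ᵣ linealityFlat q →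
                Member lineality ⊆ Member (direction L) ×
                ∃ λ δ → IsDistFromOrigin L δ × ∃ λ δ′ → IsDistFromOrigin (linealityFlat q) δ′ × δ ≤ δ′
      compare {L} L⊆K ((_ , δ) , (_ , δ′) , ((k , (v , v-basis) , ≡.refl) , dist) , ((k′ , (v′ , v′-basis) , ≡.refl) , dist′) , lex)
        with lex
      ... | inj₁ d∸k<d∸k′ = ⊥-elim (ℕ.<⇒≱ d∸k<d∸k′ (ℕ.∸-monoʳ-≤ d
              (dim-mono {lineality} {direction L} (direction⊆lineality convex L L⊆K) v′-basis v-basis)))
      ... | inj₂ (d∸k≡d∸k′ , δ≤δ′)
        with ℕ.∸-cancelˡ-≡ (independent⇒≤dim (proj₁ (proj₂ v-basis))) (independent⇒≤dim (proj₁ (proj₂ v′-basis))) d∸k≡d∸k′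
      ... | ≡.refl = equal-dim⇒⊇ {lineality} {direction L} (direction⊆lineality convex L L⊆K) v′-basis v-basis ,
                     δ , dist , δ′ , dist′ , δ≤δ′

      module _ {L : AffineFlat} (L⊆K : Points L ⊆ K) (L≤ : L ≤ᵣ linealityFlat q) where

        direction≐lineality : Member (direction L) ≐ Member lineality
        direction≐lineality = direction⊆lineality convex L L⊆K , proj₁ (compare {L} L⊆K L≤)

        -- L is itself closed and convex, so it attains its distance, necessarily at q.
        q∈flat : q ∈ Points L
        q∈flat =
          let p , p∈L , p-minimal = minimiser {Points L} (base L , base∈ L) (flat-closed L direction≐lineality) (flat-convex L)
              _ , δ , dist , δ′ , dist′ , δ≤δ′ = compare {L} L⊆K L≤
              m , ‖p‖≈m = norm p
              n , ‖q‖≈n = norm q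
              m≤n = begin
                m   ≤⟨ proj₂ dist (λ (x , x∈L , isNorm) → norm-mono-≤ ‖p‖≈m isNorm (p-minimal x∈L)) ⟩
                δ   ≤⟨ δ≤δ′ ⟩
                δ′  ≤⟨ proj₁ dist′ (q , base∈ (linealityFlat q) , ‖q‖≈n) ⟩
                n   ∎
              q≈p = minimiser-unique {K} convex minimises (L⊆K p∈L) (norm-cancel-≤ ‖p‖≈m ‖q‖≈n m≤n)
          in LinearSubspace.respects (direction L) (λ i → +-congʳ (sym (q≈p i))) p∈L

        linealityFlat≋ : linealityFlat q ≋ L
        linealityFlat≋ =
          (λ {x} x∈ → respects (λ i → solve 3 (λ x q b → (x :- q) :+ (q :- b) := x :- b) refl (x i) (q i) (base L i))
                        (+-closed (proj₂ direction≐lineality x∈) q∈flat)) ,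
          (λ {x} x∈ → proj₁ direction≐lineality
                        (respects (λ i → solve 3 (λ x q b → (x :- b) :+ (:- :1) :* (q :- b) := x :- q) refl (x i) (q i) (base L i))
                          (+-closed x∈ (·-closed (- 1#) q∈flat))))
          where open LinearSubspace (direction L)

lemma1 : ExcludedMiddle 0ℓ → (ℝ : RealField) (d : ℕ) → let open Euclidean ℝ d in
    (K : Pred Point 0ℓ) → Satisfiable K → Closed K → Convex K → ∃! _≋_ (IsM K)
lemma1 em ℝ d K K-nonempty closed convex =
  let q , minimises = minimiser {K} K-nonempty closed convex
      isM           = linealityFlat-isM {K} closed convex minimises
  -- For uniqueness, the minimality of `L` is tested against the single flat through `q`.
  in linealityFlat {K} closed q , isM , λ {L} (L⊆K , L-minimal) →
     linealityFlat≋ {K} closed convex minimises {L} L⊆K (L-minimal (linealityFlat {K} closed q) (proj₁ isM))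
  where
  open ClosestPoint em ℝ d
  open Lineality em ℝ d
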